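{- As $n \to \infty$, $$k_n \ge \frac{2 \log_2 n}{\log_2 14.864} + O(1) \approx 0.51364 \log_2 n + O(1).$$
   Context: A system of $k$ stacks in series consists of an input queue, stacks $1,\ldots,k$, and an output queue; the legal moves are: move the front element of the input queue onto stack 1, pop the top of stack $i$ and push it onto stack $i+1$ ($1\le i<k$), and pop the top of stack $k$ and enqueue it on the output queue. A permutation $\pi\in S_n$ is sortable by $k$ stacks if, starting with input queue (front to back) $\pi(1),\ldots,\pi(n)$ and all else empty, some finite sequence of legal moves ends with the output queue containing $1,\ldots,n$ in sorted order. $k_n$ denotes the smallest number $k$ of stacks in series such that every permutation of $n$ elements is sortable by $k$ stacks. -}

module Defs where

open import Data.Nat using (ℕ; zero; suc; _+_; _*_; _^_; _≤_)
open import Data.Fin using (Fin; toℕ)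
open import Data.Fin.Permutation using (Permutation′; _⟨$⟩ʳ_)
open import Data.List using (List; []; _∷_; _++_; [_]; map; upTo; allFin)
open import Data.Vec using (Vec; lookup; _[_]≔_; replicate)
open import Data.Product using (_×_; _,_; ∃)
open import Relation.Binary.PropositionalEquality using (_≡_)
open import Relation.Binary.Construct.Closure.ReflexiveTransitive using (Star)

-- A configuration of k stacks in series:
--   input queue (front = head), stacks 1..k (indexed by Fin k, index 0 = stack 1,
--   top of a stack = head of its list), output queue (front = head, enqueue at the end).
record Config (k : ℕ) : Set where
  constructor cfg
  field
    input  : List ℕ
    stacks : Vec (List ℕ) k
    output : List ℕ

data Step {k : ℕ} : Config k → Config k → Set where
  push : ∀ {x xs s out} (i : Fin k) → toℕ i ≡ 0 →
         Step (cfg (x ∷ xs) s out) (cfg xs (s [ i ]≔ (x ∷ lookup s i)) out)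
  move : ∀ {inp s out x ys} (i j : Fin k) → toℕ j ≡ suc (toℕ i) →
         lookup s i ≡ x ∷ ys →
         Step (cfg inp s out) (cfg inp ((s [ i ]≔ ys) [ j ]≔ (x ∷ lookup s j)) out)
  pop  : ∀ {inp s out x ys} (i : Fin k) → suc (toℕ i) ≡ k →
         lookup s i ≡ x ∷ ys →
         Step (cfg inp s out) (cfg inp (s [ i ]≔ ys) (out ++ [ x ]))

permWord : ∀ {n} → Permutation′ n → List ℕ
permWord {n} π = map (λ i → toℕ (π ⟨$⟩ʳ i)) (allFin n)

SortableBy : ℕ → ∀ {n} → Permutation′ n → Set
SortableBy k {n} π =
  Star (Step {k}) (cfg (permWord π) (replicate k []) [])
                  (cfg [] (replicate k []) (upTo n))

AllSortable : ℕ → ℕ → Set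
AllSortable n k = (π : Permutation′ n) → SortableBy k π

{-# OPTIONS --safe #-}

-- Two consecutive stacks act by a word in the moves ρ (input to the first stack),
-- ℓ (first to second stack) and μ (second stack to output). The rewrite rules
--   ρμ → μρ,   ρℓμℓ → ℓρℓμ,   ρρℓℓμμℓ → ℓρρℓℓμμ
-- do not change the effect of a word, so every word may be replaced by one that avoids
-- the left-hand sides. A weighted count with a nine-state automaton shows that there are
-- at most 14.864ⁿ such words with n moves of each kind once n is large. The k stacks
-- form ⌈k/2⌉ such pairs, and words and output determine the input, so
-- n! ≤ 14.864^(n⌈k/2⌉); taking n-th roots in (n/4)ⁿ ≤ n! gives the bound.
module Submission where

open import Defs
open import Data.Bool using (Bool; true; false; T; if_then_else_)
open import Data.Fin using (Fin; zero; suc; toℕ; combine; remQuot; punchIn)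
open import Data.Fin.Permutation using (Permutation′; _⟨$⟩ʳ_; insert; insert-punchIn) renaming (id to idₚ)
open import Data.Fin.Properties using (toℕ-injective; punchIn-injective; combine-remQuot; injective⇒≤)
open import Data.List using (List; []; _∷_; [_]; _++_; map; length; reverse; _ʳ++_; cartesianProductWith; upTo; allFin; lookup)
open import Data.List.Membership.Propositional using (_∈_)
open import Data.List.Membership.Propositional.Properties using (∈-++⁺ˡ; ∈-++⁺ʳ; ∈-cartesianProductWith⁺; ∈-allFin)
open import Data.List.Properties using (∷-injectiveˡ; ∷-injectiveʳ; length-++; length-map; length-tabulate; reverse-involutive; ++-identityʳ; ++-assoc)
open import Data.List.Relation.Unary.Any using (here; there; index)
open import Data.List.Relation.Unary.Any.Properties using (lookup-index)
open import Data.Nat using (ℕ; zero; suc; _+_; _*_; _^_; _∸_; _!; _≤_; z≤n; s≤s; ⌊_/2⌋; ⌈_/2⌉; NonZero; >-nonZero)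
open import Data.Nat.Properties
open import Data.Nat.Tactic.RingSolver using (solve-∀)
open import Data.Product using (∃; _×_; _,_; proj₁; proj₂; uncurry)
open import Data.Unit using (⊤; tt)
open import Data.Vec as Vec using (Vec; []; _∷_; replicate; _[_]≔_)
open import Relation.Binary.Construct.Closure.ReflexiveTransitive using (Star; ε; _◅_)
open import Relation.Binary.PropositionalEquality using (_≡_; refl; sym; trans; cong; cong₂; subst; module ≡-Reasoning)

-- Words of moves and their runs on two stacks

data Move : Set where
  ρ ℓ μ : Move

Word : Set
Word = List Move

-- Run w xs s t ys: from input xs and stacks s, t, the moves w empty the system
-- and output ys.
data Run : Word → List ℕ → List ℕ → List ℕ → List ℕ → Set where
  []  : Run [] [] [] [] []
  ρ∷_ : ∀ {w x xs s t ys} → Run w xs (x ∷ s) t ys → Run (ρ ∷ w) (x ∷ xs) s t ys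
  ℓ∷_ : ∀ {w x xs s t ys} → Run w xs s (x ∷ t) ys → Run (ℓ ∷ w) xs (x ∷ s) t ys
  μ∷_ : ∀ {w x xs s t ys} → Run w xs s t ys → Run (μ ∷ w) xs s (x ∷ t) (x ∷ ys)

infixr 5 ρ∷_ ℓ∷_ μ∷_

-- Splitting a run of k stacks into single-stack and two-stack passes

-- Only the order of a stack's own pushes and pops is kept. How different stacks interleave is
-- forgotten; neighbours share just the stream of items handed over.
data Pass : List ℕ → List ℕ → List ℕ → Set where
  done : Pass [] [] []
  push : ∀ {x xs s ys} → Pass xs (x ∷ s) ys → Pass (x ∷ xs) s ys
  pop  : ∀ {x xs s ys} → Pass xs s ys → Pass xs (x ∷ s) (x ∷ ys)

-- A stack that pops every item at once changes nothing; it serves as the missing partner of the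
-- last stack when `k` is odd.
pass-id : ∀ xs → Pass xs [] xs
pass-id []       = done
pass-id (x ∷ xs) = push (pop (pass-id xs))

-- The first stack reads input until it must pop; then the second stack pops until it must push, and
-- the two actions become one ℓ.
merge : ∀ {xs s ms t ys} → Pass xs s ms → Pass ms t ys → ∃ λ w → Run w xs s t ys
merge done     done     = [] , []
merge (push p) q        = let w , r = merge p q in ρ ∷ w , ρ∷ r
merge done     (pop q)  = let w , r = merge done q in μ ∷ w , μ∷ r
merge (pop p)  (pop q)  = let w , r = merge (pop p) q in μ ∷ w , μ∷ r
merge (pop p)  (push q) = let w , r = merge p q in ℓ ∷ w , ℓ∷ r

Passes : ∀ {k} → Vec (List ℕ) k → List ℕ → List ℕ → Set
Passes []       xs ys = xs ≡ ys
Passes (s ∷ ss) xs ys = ∃ λ ms → Pass xs s ms × Passes ss ms ys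

passes-empty : ∀ k → Passes (replicate k []) [] []
passes-empty zero    = refl
passes-empty (suc k) = [] , done , passes-empty k

passes-move : ∀ {k x ys xs zs} (s : Vec (List ℕ) k) (i j : Fin k) → toℕ j ≡ suc (toℕ i) →
  Vec.lookup s i ≡ x ∷ ys →
  Passes ((s [ i ]≔ ys) [ j ]≔ (x ∷ Vec.lookup s j)) xs zs → Passes s xs zs
passes-move (_ ∷ _ ∷ _) zero (suc zero) refl refl (ms , p , ls , q , rest) = _ , pop p , ls , push q , rest
passes-move (_ ∷ s) (suc i) (suc j) eq top (ms , p , rest) = ms , p , passes-move s i j (suc-injective eq) top rest

passes-pop : ∀ {k x ys xs zs} (s : Vec (List ℕ) k) (i : Fin k) → suc (toℕ i) ≡ k →
  Vec.lookup s i ≡ x ∷ ys →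
  Passes (s [ i ]≔ ys) xs zs → Passes s xs (x ∷ zs)
passes-pop (_ ∷ []) zero refl refl (ms , p , refl) = _ , pop p , refl
passes-pop (_ ∷ s) (suc i) eq top (ms , p , rest) = ms , p , passes-pop s i (suc-injective eq) top rest

-- The passes are assembled from the last move backwards, hence the arbitrary starting
-- configuration; `ys` is the output still to come.
star⇒passes : ∀ {k xs s out fin} → Star Step (cfg xs s out) (cfg [] (replicate k []) fin) →
  ∃ λ ys → out ++ ys ≡ fin × Passes s xs ys
star⇒passes {k} {out = out} ε = [] , ++-identityʳ out , passes-empty k
star⇒passes {s = _ ∷ _} (push zero refl ◅ st) =
  let ys , eq , ms , p , rest = star⇒passes st in ys , eq , ms , push p , rest
star⇒passes {s = s} (move i j adj top ◅ st) =
  let ys , eq , ps = star⇒passes st in ys , eq , passes-move s i j adj top ps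
star⇒passes {s = s} {out} (pop {x = x} i last top ◅ st) =
  let ys , eq , ps = star⇒passes st in
  x ∷ ys , trans (sym (++-assoc out [ x ] ys)) eq , passes-pop s i last top ps

Chain : ℕ → List ℕ → List ℕ → Set
Chain zero    xs ys = xs ≡ ys
Chain (suc m) xs ys = ∃ λ ms → (∃ λ w → Run w xs [] [] ms) × Chain m ms ys

passes⇒chain : ∀ k {xs ys} → Passes (replicate k []) xs ys → Chain ⌈ k /2⌉ xs ys
passes⇒chain zero          eq                      = eq
passes⇒chain (suc zero)    (ms , p , eq)           = ms , merge p (pass-id ms) , eq
passes⇒chain (suc (suc k)) (ms , p , ls , q , rest) = ls , merge p q , passes⇒chain k rest

sortable⇒chain : ∀ k {n} (π : Permutation′ n) → SortableBy k π → Chain ⌈ k /2⌉ (permWord π) (upTo n)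
sortable⇒chain k π st with star⇒passes st
... | ys , refl , ps = passes⇒chain k ps

-- Normal forms

-- The longest prefix of a word that can be part of a redex begun further left (M stands
-- for every other word beginning with μ).
data State : Set where
  ∅ M L ML LML MML LMML LLMML RLLMML : State

spell : State → Word
spell ∅      = []
spell M      = μ ∷ []
spell L      = ℓ ∷ []
spell ML     = μ ∷ ℓ ∷ []
spell LML    = ℓ ∷ μ ∷ ℓ ∷ []
spell MML    = μ ∷ μ ∷ ℓ ∷ []
spell LMML   = ℓ ∷ μ ∷ μ ∷ ℓ ∷ []
spell LLMML  = ℓ ∷ ℓ ∷ μ ∷ μ ∷ ℓ ∷ []
spell RLLMML = ρ ∷ ℓ ∷ ℓ ∷ μ ∷ μ ∷ ℓ ∷ []

-- An Aho-Corasick automaton for the left-hand sides, run from right to left. A failed match falls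
-- back to a shorter one: μ before ℓμℓ leaves only μℓ.
prepend : Move → State → State
prepend ρ LLMML  = RLLMML
prepend ρ _      = ∅
prepend ℓ ML     = LML
prepend ℓ MML    = LMML
prepend ℓ LMML   = LLMML
prepend ℓ _      = L
prepend μ L      = ML
prepend μ LML    = ML
prepend μ LMML   = ML
prepend μ LLMML  = ML
prepend μ ML     = MML
prepend μ _      = M

state : Word → State
state []      = ∅
state (c ∷ w) = prepend c (state w)

-- Every redex begins with ρ; free says that prepending ρ does not create one.
free : State → Bool
free ∅     = true
free L     = true
free LMML  = true
free LLMML = true
free _     = false

Normal : Word → Set
Normal []      = ⊤
Normal (ρ ∷ w) = T (free (state w)) × Normal w
Normal (ℓ ∷ w) = Normal w
Normal (μ ∷ w) = Normal w

-- Recovers from a state the letters it stands for, so that a rewrite rule can be applied to them.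
state-prefix : ∀ w → ∃ λ v → w ≡ spell (state w) ++ v
state-prefix [] = [] , refl
state-prefix (c ∷ w) with state w | state-prefix w
state-prefix (ρ ∷ w) | ∅      | v , refl = _ , refl
state-prefix (ρ ∷ w) | M      | v , refl = _ , refl
state-prefix (ρ ∷ w) | L      | v , refl = _ , refl
state-prefix (ρ ∷ w) | ML     | v , refl = _ , refl
state-prefix (ρ ∷ w) | LML    | v , refl = _ , refl
state-prefix (ρ ∷ w) | MML    | v , refl = _ , refl
state-prefix (ρ ∷ w) | LMML   | v , refl = _ , refl
state-prefix (ρ ∷ w) | LLMML  | v , refl = _ , refl
state-prefix (ρ ∷ w) | RLLMML | v , refl = _ , refl
state-prefix (ℓ ∷ w) | ∅      | v , refl = _ , refl
state-prefix (ℓ ∷ w) | M      | v , refl = _ , refl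
state-prefix (ℓ ∷ w) | L      | v , refl = _ , refl
state-prefix (ℓ ∷ w) | ML     | v , refl = _ , refl
state-prefix (ℓ ∷ w) | LML    | v , refl = _ , refl
state-prefix (ℓ ∷ w) | MML    | v , refl = _ , refl
state-prefix (ℓ ∷ w) | LMML   | v , refl = _ , refl
state-prefix (ℓ ∷ w) | LLMML  | v , refl = _ , refl
state-prefix (ℓ ∷ w) | RLLMML | v , refl = _ , refl
state-prefix (μ ∷ w) | ∅      | v , refl = _ , refl
state-prefix (μ ∷ w) | M      | v , refl = _ , refl
state-prefix (μ ∷ w) | L      | v , refl = _ , refl
state-prefix (μ ∷ w) | ML     | v , refl = _ , refl
state-prefix (μ ∷ w) | LML    | v , refl = _ , refl
state-prefix (μ ∷ w) | MML    | v , refl = _ , refl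
state-prefix (μ ∷ w) | LMML   | v , refl = _ , refl
state-prefix (μ ∷ w) | LLMML  | v , refl = _ , refl
state-prefix (μ ∷ w) | RLLMML | v , refl = _ , refl

-- No left-hand side begins with ρℓℓ.
free-ℓℓ : ∀ s → T (free (prepend ℓ (prepend ℓ s)))
free-ℓℓ ∅      = tt
free-ℓℓ M      = tt
free-ℓℓ L      = tt
free-ℓℓ ML     = tt
free-ℓℓ LML    = tt
free-ℓℓ MML    = tt
free-ℓℓ LMML   = tt
free-ℓℓ LLMML  = tt
free-ℓℓ RLLMML = tt

-- Rewriting to normal form

infix 4 _⊑_

_⊑_ : Word → Word → Set
w ⊑ v = ∀ {xs s t ys} → Run w xs s t ys → Run v xs s t ys

⊑-refl : ∀ {w} → w ⊑ w
⊑-refl r = r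

⊑-trans : ∀ {u v w} → u ⊑ v → v ⊑ w → u ⊑ w
⊑-trans f g r = g (f r)

⊑-cons : ∀ c {w v} → w ⊑ v → c ∷ w ⊑ c ∷ v
⊑-cons ρ f (ρ∷ r) = ρ∷ f r
⊑-cons ℓ f (ℓ∷ r) = ℓ∷ f r
⊑-cons μ f (μ∷ r) = μ∷ f r

swap-ρμ : ∀ {w} → ρ ∷ μ ∷ w ⊑ μ ∷ ρ ∷ w
swap-ρμ (ρ∷ μ∷ r) = μ∷ ρ∷ r

-- A complete excursion ρℓμ or ρρℓℓμμ of fresh items leaves both stacks as they
-- were, so it commutes with ℓ.
swap-ρℓμ : ∀ {w} → ρ ∷ ℓ ∷ μ ∷ ℓ ∷ w ⊑ ℓ ∷ ρ ∷ ℓ ∷ μ ∷ w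
swap-ρℓμ (ρ∷ ℓ∷ μ∷ ℓ∷ r) = ℓ∷ ρ∷ ℓ∷ μ∷ r

swap-ρρℓℓμμ : ∀ {w} → ρ ∷ ρ ∷ ℓ ∷ ℓ ∷ μ ∷ μ ∷ ℓ ∷ w ⊑ ℓ ∷ ρ ∷ ρ ∷ ℓ ∷ ℓ ∷ μ ∷ μ ∷ w
swap-ρρℓℓμμ (ρ∷ ρ∷ ℓ∷ ℓ∷ μ∷ μ∷ ℓ∷ r) = ℓ∷ ρ∷ ρ∷ ℓ∷ ℓ∷ μ∷ μ∷ r

-- Each rule brings an ℓ or μ to the front, where it creates no redex, and leaves a ρ to insert into
-- a word shorter by one. That word need not be a subterm of `w`, so the recursion is on the length.
insert-ρ : ∀ n w → length w ≡ n → Normal w → ∃ λ v → Normal v × (ρ ∷ w ⊑ v)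
insert-ρ n w len nw with state w in st | state-prefix w
... | ∅      | _ = ρ ∷ w , (subst (λ s → T (free s)) (sym st) tt , nw) , ⊑-refl
... | L      | _ = ρ ∷ w , (subst (λ s → T (free s)) (sym st) tt , nw) , ⊑-refl
... | LMML   | _ = ρ ∷ w , (subst (λ s → T (free s)) (sym st) tt , nw) , ⊑-refl
... | LLMML  | _ = ρ ∷ w , (subst (λ s → T (free s)) (sym st) tt , nw) , ⊑-refl
insert-ρ (suc n) _ len nw | M | v , refl =
  let u , nu , f = insert-ρ n v (suc-injective len) nw
  in μ ∷ u , nu , ⊑-trans swap-ρμ (⊑-cons μ f)
insert-ρ (suc n) _ len nw | ML | v , refl =
  let u , nu , f = insert-ρ n _ (suc-injective len) nw
  in μ ∷ u , nu , ⊑-trans swap-ρμ (⊑-cons μ f)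
insert-ρ (suc n) _ len nw | MML | v , refl =
  let u , nu , f = insert-ρ n _ (suc-injective len) nw
  in μ ∷ u , nu , ⊑-trans swap-ρμ (⊑-cons μ f)
insert-ρ (suc n) _ len nw | LML | v , refl =
  let u , nu , f = insert-ρ n (ℓ ∷ μ ∷ v) (suc-injective len) nw
  in ℓ ∷ u , nu , ⊑-trans swap-ρℓμ (⊑-cons ℓ f)
-- Removing the ℓ changes what follows the inner ρ, so its condition has to be established anew by
-- `free-ℓℓ`.
insert-ρ (suc n) _ len (_ , nw) | RLLMML | v , refl =
  let u , nu , f = insert-ρ n (ρ ∷ ℓ ∷ ℓ ∷ μ ∷ μ ∷ v) (suc-injective len) (free-ℓℓ (state (μ ∷ μ ∷ v)) , nw)
  in ℓ ∷ u , nu , ⊑-trans swap-ρρℓℓμμ (⊑-cons ℓ f)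

normalise : ∀ w → ∃ λ v → Normal v × (w ⊑ v)
normalise [] = [] , tt , ⊑-refl
normalise (ρ ∷ w) =
  let v , nv , f = normalise w
      u , nu , g = insert-ρ (length v) v refl nv
  in u , nu , ⊑-trans (⊑-cons ρ f) g
normalise (ℓ ∷ w) = let v , nv , f = normalise w in ℓ ∷ v , nv , ⊑-cons ℓ f
normalise (μ ∷ w) = let v , nv , f = normalise w in μ ∷ v , nv , ⊑-cons μ f

-- Counting normal words

occ : Move → Move → ℕ
occ ρ ρ = 1
occ ℓ ℓ = 1
occ μ μ = 1
occ _ _ = 0

# : Move → Word → ℕ
# c []      = 0
# c (d ∷ w) = occ c d + # c w

#-ʳ++ : ∀ c u {w} → # c (u ʳ++ w) ≡ # c u + # c w
#-ʳ++ c []      = refl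
#-ʳ++ c (d ∷ u) {w} = trans (#-ʳ++ c u) (rearrange (# c u) (occ c d) (# c w))
  where
  rearrange : ∀ a b e → a + (b + e) ≡ b + a + e
  rearrange = solve-∀

#-reverse : ∀ c w → # c (reverse w) ≡ # c w
#-reverse c w = trans (#-ʳ++ c w) (+-identityʳ (# c w))

stop extend extendρ extendℓ extendμ : ℕ → ℕ → ℕ → Word → List Word

stop zero zero zero w = [ w ]
stop _    _    _    w = []

-- All normal words u ++ w such that u has r, l and m occurrences of ρ, ℓ and μ.
extend r l m w = stop r l m w ++ extendρ r l m w ++ extendℓ r l m w ++ extendμ r l m w

extendρ zero    l m w = []
extendρ (suc r) l m w = if free (state w) then extend r l m (ρ ∷ w) else []

extendℓ r zero    m w = []
extendℓ r (suc l) m w = extend r l m (ℓ ∷ w)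

extendμ r l zero    w = []
extendμ r l (suc m) w = extend r l m (μ ∷ w)

normal-tail : ∀ c {w} → Normal (c ∷ w) → Normal w
normal-tail ρ = proj₂
normal-tail ℓ n = n
normal-tail μ n = n

normal-suffix : ∀ u {w} → Normal (u ʳ++ w) → Normal w
normal-suffix []      n = n
normal-suffix (c ∷ u) n = normal-tail c (normal-suffix u n)

∈-if : ∀ {A : Set} {x : A} {xs} b → T b → x ∈ xs → x ∈ (if b then xs else [])
∈-if true _ x∈xs = x∈xs

-- With `u` reversed, its head is the letter next to `w`, which is the one `extend` prepends first.
∈-extend : ∀ u {w} → Normal (u ʳ++ w) → u ʳ++ w ∈ extend (# ρ u) (# ℓ u) (# μ u) w
∈-extend [] n = here refl
∈-extend (ρ ∷ u) {w} n =
  ∈-++⁺ˡ (∈-if (free (state w)) (proj₁ (normal-suffix u n)) (∈-extend u n))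
∈-extend (ℓ ∷ u) {w} n = let r = # ρ u; l = # ℓ u; m = # μ u in
  ∈-++⁺ʳ (stop r (suc l) m w) (∈-++⁺ʳ (extendρ r (suc l) m w) (∈-++⁺ˡ (∈-extend u n)))
∈-extend (μ ∷ u) {w} n = let r = # ρ u; l = # ℓ u; m = # μ u in
  ∈-++⁺ʳ (stop r l (suc m) w) (∈-++⁺ʳ (extendρ r l (suc m) w) (∈-++⁺ʳ (extendℓ r l (suc m) w) (∈-extend u n)))

normal∈extend : ∀ w {r l m} → Normal w → # ρ w ≡ r → # ℓ w ≡ l → # μ w ≡ m → w ∈ extend r l m []
normal∈extend w n refl refl refl
  rewrite sym (#-reverse ρ w) | sym (#-reverse ℓ w) | sym (#-reverse μ w)
  = subst (_∈ extend (# ρ (reverse w)) (# ℓ (reverse w)) (# μ (reverse w)) []) (reverse-involutive w)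
      (∈-extend (reverse w) (subst Normal (sym (reverse-involutive w)) n))

normals : ℕ → List Word
normals n = extend n n n []

^-distribʳ-* : ∀ a b n → (a * b) ^ n ≡ a ^ n * b ^ n
^-distribʳ-* a b zero    = refl
^-distribʳ-* a b (suc n) =
  trans (cong (a * b *_) (^-distribʳ-* a b n)) ([m*n]*[o*p]≡[m*o]*[n*p] a b (a ^ n) (b ^ n))

length-++³ : ∀ {A : Set} (xs ys zs : List A) → length (xs ++ ys ++ zs) ≡ length xs + (length ys + length zs)
length-++³ xs ys zs = trans (length-++ xs) (cong (length xs +_) (length-++ ys))

-- The moves ρ, ℓ, μ carry the weights 1/2, p/q, 1/2; if the potential does not
-- increase under the weighted transitions of the automaton, it bounds the number of
-- normal words.
module TransferBound
  (potential : State → ℕ) (v p q : ℕ) .{{_ : NonZero q}}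
  (v≤potential : ∀ s → v ≤ potential s)
  (potential-step : ∀ s →
    q * (if free s then potential (prepend ρ s) else 0)
      + 2 * p * potential (prepend ℓ s) + q * potential (prepend μ s) ≤ 2 * q * potential s)
  where

  open ≤-Reasoning

  potentialρ : State → ℕ
  potentialρ s = if free s then potential (prepend ρ s) else 0

  -- The denominator of the weight of a word with these letter counts; the numerator `p ^ l` appears
  -- on the other side of the inequalities.
  weight : ℕ → ℕ → ℕ → ℕ
  weight r l m = 2 ^ r * q ^ l * 2 ^ m

  -- Over the common denominator `2 * q` the three bounds add up to the left side of
  -- `potential-step`.
  combine-bounds : ∀ a b c D W s →
    2 * (a * D) ≤ potentialρ s * W →
    q * (b * D) ≤ p * (potential (prepend ℓ s) * W) →
    2 * (c * D) ≤ potential (prepend μ s) * W →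
    (a + (b + c)) * D ≤ potential s * W
  combine-bounds a b c D W s ha hb hc = *-cancelˡ-≤ (2 * q) {{m*n≢0 2 q}} (begin
    2 * q * ((a + (b + c)) * D)
      ≡⟨ expand q a b c D ⟩
    q * (2 * (a * D)) + 2 * (q * (b * D)) + q * (2 * (c * D))
      ≤⟨ +-mono-≤ (+-mono-≤ (*-monoʳ-≤ q ha) (*-monoʳ-≤ 2 hb)) (*-monoʳ-≤ q hc) ⟩
    q * (P * W) + 2 * (p * (Q * W)) + q * (R * W)
      ≡⟨ collect p q P Q R W ⟩
    (q * P + 2 * p * Q + q * R) * W
      ≤⟨ *-monoˡ-≤ W (potential-step s) ⟩
    2 * q * potential s * W
      ≡⟨ *-assoc (2 * q) (potential s) W ⟩
    2 * q * (potential s * W) ∎)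
    where
    P Q R : ℕ
    P = potentialρ s
    Q = potential (prepend ℓ s)
    R = potential (prepend μ s)
    expand : ∀ q a b c D → 2 * q * ((a + (b + c)) * D) ≡ q * (2 * (a * D)) + 2 * (q * (b * D)) + q * (2 * (c * D))
    expand = solve-∀
    collect : ∀ p q P Q R W → q * (P * W) + 2 * (p * (Q * W)) + q * (R * W) ≡ (q * P + 2 * p * Q + q * R) * W
    collect = solve-∀

  extend-bound : ∀ r l m w → length (extend r l m w) * (v * p ^ l) ≤ potential (state w) * weight r l m
  extendρ-bound : ∀ r l m w → 2 * (length (extendρ r l m w) * (v * p ^ l)) ≤ potentialρ (state w) * weight r l m
  extendℓ-bound : ∀ r l m w →
    q * (length (extendℓ r l m w) * (v * p ^ l)) ≤ p * (potential (prepend ℓ (state w)) * weight r l m)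
  extendμ-bound : ∀ r l m w →
    2 * (length (extendμ r l m w) * (v * p ^ l)) ≤ potential (prepend μ (state w)) * weight r l m
  extend-step : ∀ r l m w →
    length (extendρ r l m w ++ extendℓ r l m w ++ extendμ r l m w) * (v * p ^ l) ≤ potential (state w) * weight r l m

  -- The only case where `stop` yields a word; in the others it is empty and the three extensions
  -- account for everything.
  extend-bound zero    zero    zero    w = begin
    1 * (v * 1)               ≡⟨ trans (*-identityˡ (v * 1)) (*-identityʳ v) ⟩
    v                         ≤⟨ v≤potential (state w) ⟩
    potential (state w)       ≡⟨ *-identityʳ (potential (state w)) ⟨
    potential (state w) * 1   ∎
  extend-bound zero    zero    (suc m) w = extend-step zero zero (suc m) w
  extend-bound zero    (suc l) m       w = extend-step zero (suc l) m w
  extend-bound (suc r) l       m       w = extend-step (suc r) l m w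

  extend-step r l m w
    rewrite length-++³ (extendρ r l m w) (extendℓ r l m w) (extendμ r l m w)
    = combine-bounds (length (extendρ r l m w)) (length (extendℓ r l m w)) (length (extendμ r l m w))
        (v * p ^ l) (weight r l m) (state w)
        (extendρ-bound r l m w) (extendℓ-bound r l m w) (extendμ-bound r l m w)

  extendρ-bound zero    l m w = z≤n
  extendρ-bound (suc r) l m w with free (state w) | extend-bound r l m (ρ ∷ w)
  ... | false | _  = z≤n
  ... | true  | ih = ≤-trans (*-monoʳ-≤ 2 ih) (≤-reflexive (regroup (potential (prepend ρ (state w))) (2 ^ r) (q ^ l) (2 ^ m)))
    where
    regroup : ∀ p a b c → 2 * (p * (a * b * c)) ≡ p * (2 * a * b * c)
    regroup = solve-∀

  extendℓ-bound r zero    m w = ≤-trans (≤-reflexive (*-zeroʳ q)) z≤n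
  extendℓ-bound r (suc l) m w = begin
    q * (length (extend r l m (ℓ ∷ w)) * (v * (p * p ^ l)))
      ≡⟨ regroupˡ p q v (length (extend r l m (ℓ ∷ w))) (p ^ l) ⟩
    p * q * (length (extend r l m (ℓ ∷ w)) * (v * p ^ l))
      ≤⟨ *-monoʳ-≤ (p * q) (extend-bound r l m (ℓ ∷ w)) ⟩
    p * q * (potential (prepend ℓ (state w)) * weight r l m)
      ≡⟨ regroupʳ p q (potential (prepend ℓ (state w))) (2 ^ r) (q ^ l) (2 ^ m) ⟩
    p * (potential (prepend ℓ (state w)) * weight r (suc l) m) ∎
    where
    regroupˡ : ∀ p q v n d → q * (n * (v * (p * d))) ≡ p * q * (n * (v * d))
    regroupˡ = solve-∀
    regroupʳ : ∀ p q x a b c → p * q * (x * (a * b * c)) ≡ p * (x * (a * (q * b) * c))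
    regroupʳ = solve-∀

  extendμ-bound r l zero    w = z≤n
  extendμ-bound r l (suc m) w =
    ≤-trans (*-monoʳ-≤ 2 (extend-bound r l m (μ ∷ w))) (≤-reflexive (regroup (potential (prepend μ (state w))) (2 ^ r) (q ^ l) (2 ^ m)))
    where
    regroup : ∀ p a b c → 2 * (p * (a * b * c)) ≡ p * (a * b * (2 * c))
    regroup = solve-∀

  -- A word with `n` letters of each kind has weight (p/4q)ⁿ, so the growth rate is at most 4q/p.
  normals-bound : ∀ n → length (normals n) * p ^ n * v ≤ potential ∅ * (2 * q * 2) ^ n
  normals-bound n = begin
    length (normals n) * p ^ n * v   ≡⟨ regroup (length (normals n)) (p ^ n) v ⟩
    length (normals n) * (v * p ^ n) ≤⟨ extend-bound n n n [] ⟩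
    potential ∅ * weight n n n       ≡⟨ cong (λ x → potential ∅ * (x * 2 ^ n)) (^-distribʳ-* 2 q n) ⟨
    potential ∅ * ((2 * q) ^ n * 2 ^ n) ≡⟨ cong (potential ∅ *_) (^-distribʳ-* (2 * q) 2 n) ⟨
    potential ∅ * (2 * q * 2) ^ n    ∎
    where
    regroup : ∀ a b c → a * b * c ≡ a * (c * b)
    regroup = solve-∀

-- An integer multiple of an approximate Perron eigenvector for the weights 1/2, 1000/3714, 1/2.
potential : State → ℕ
potential ∅      = 628
potential M      = 314
potential L      = 583
potential ML     = 224
potential LML    = 269
potential MML    = 303
potential LMML   = 541
potential LLMML  = 426
potential RLLMML = 314

224≤potential : ∀ s → 224 ≤ potential s
224≤potential ∅      = ≤ᵇ⇒≤ _ _ tt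
224≤potential M      = ≤ᵇ⇒≤ _ _ tt
224≤potential L      = ≤ᵇ⇒≤ _ _ tt
224≤potential ML     = ≤ᵇ⇒≤ _ _ tt
224≤potential LML    = ≤ᵇ⇒≤ _ _ tt
224≤potential MML    = ≤ᵇ⇒≤ _ _ tt
224≤potential LMML   = ≤ᵇ⇒≤ _ _ tt
224≤potential LLMML  = ≤ᵇ⇒≤ _ _ tt
224≤potential RLLMML = ≤ᵇ⇒≤ _ _ tt

potential-step : ∀ s →
  3714 * (if free s then potential (prepend ρ s) else 0)
    + 2 * 1000 * potential (prepend ℓ s) + 3714 * potential (prepend μ s) ≤ 2 * 3714 * potential s
potential-step ∅      = ≤ᵇ⇒≤ _ _ tt
potential-step M      = ≤ᵇ⇒≤ _ _ tt
potential-step L      = ≤ᵇ⇒≤ _ _ tt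
potential-step ML     = ≤ᵇ⇒≤ _ _ tt
potential-step LML    = ≤ᵇ⇒≤ _ _ tt
potential-step MML    = ≤ᵇ⇒≤ _ _ tt
potential-step LMML   = ≤ᵇ⇒≤ _ _ tt
potential-step LLMML  = ≤ᵇ⇒≤ _ _ tt
potential-step RLLMML = ≤ᵇ⇒≤ _ _ tt

-- Every factor beyond the exponent `N` favours the right side, so one numerical check suffices.
^-ratio-mono : ∀ {a b x y N n} → a ≤ b → N ≤ n → x * a ^ N ≤ b ^ N * y → x * a ^ n ≤ b ^ n * y
^-ratio-mono {a} {b} {x} {y} {N} {n} a≤b N≤n base = begin
  x * a ^ n                 ≡⟨ cong (x *_) (split a) ⟩
  x * (a ^ N * a ^ (n ∸ N)) ≡⟨ *-assoc x (a ^ N) (a ^ (n ∸ N)) ⟨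
  x * a ^ N * a ^ (n ∸ N)   ≤⟨ *-mono-≤ base (^-monoˡ-≤ (n ∸ N) a≤b) ⟩
  b ^ N * y * b ^ (n ∸ N)   ≡⟨ swap (b ^ N) y (b ^ (n ∸ N)) ⟩
  b ^ N * b ^ (n ∸ N) * y   ≡⟨ cong (_* y) (split b) ⟨
  b ^ n * y                 ∎
  where
  open ≤-Reasoning
  split : ∀ a → a ^ n ≡ a ^ N * a ^ (n ∸ N)
  split a = trans (cong (a ^_) (sym (m+[n∸m]≡n N≤n))) (^-distribˡ-+-* a N (n ∸ N))
  swap : ∀ a b c → a * b * c ≡ a * c * b
  swap = solve-∀

-- The gap between 4 * 3714 and 14864 pays for the constant factor 628/224.
constant-absorbed : ∀ n → 2000 ≤ n → 628 * (2 * 3714 * 2) ^ n ≤ 14864 ^ n * 224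
constant-absorbed n 2000≤n = ^-ratio-mono {2 * 3714 * 2} {14864} {628} {224} {2000} {n} (≤ᵇ⇒≤ 14856 14864 tt) 2000≤n
  (≤ᵇ⇒≤ (628 * (2 * 3714 * 2) ^ 2000) (14864 ^ 2000 * 224) tt)

normals-rate : ∀ n → 2000 ≤ n → length (normals n) * 1000 ^ n ≤ 14864 ^ n
normals-rate n 2000≤n = *-cancelʳ-≤ _ _ 224 (≤-trans
  (TransferBound.normals-bound potential 224 1000 3714 224≤potential potential-step n)
  (constant-absorbed n 2000≤n))

-- Counting sortable permutations

-- Every item still to pass one of the three gates does so exactly once; from empty stacks this
-- gives `n` letters of each kind.
run-#ρ : ∀ {w xs s t ys} → Run w xs s t ys → # ρ w ≡ length xs
run-#ρ []      = refl
run-#ρ (ρ∷ r) = cong suc (run-#ρ r)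
run-#ρ (ℓ∷ r) = run-#ρ r
run-#ρ (μ∷ r) = run-#ρ r

run-#ℓ : ∀ {w xs s t ys} → Run w xs s t ys → # ℓ w ≡ length s + length xs
run-#ℓ []     = refl
run-#ℓ {xs = _ ∷ xs} {s} (ρ∷ r) = trans (run-#ℓ r) (sym (+-suc (length s) (length xs)))
run-#ℓ (ℓ∷ r) = cong suc (run-#ℓ r)
run-#ℓ (μ∷ r) = run-#ℓ r

run-#μ : ∀ {w xs s t ys} → Run w xs s t ys → # μ w ≡ length t + (length s + length xs)
run-#μ []     = refl
run-#μ {xs = _ ∷ xs} {s} {t} (ρ∷ r) =
  trans (run-#μ r) (cong (length t +_) (sym (+-suc (length s) (length xs))))
run-#μ {xs = xs} {_ ∷ s} {t} (ℓ∷ r) = trans (run-#μ r) (sym (+-suc (length t) (length s + length xs)))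
run-#μ (μ∷ r) = cong suc (run-#μ r)

run-length : ∀ {w xs s t ys} → Run w xs s t ys → length ys ≡ # μ w
run-length []     = refl
run-length (ρ∷ r) = run-length r
run-length (ℓ∷ r) = run-length r
run-length (μ∷ r) = cong suc (run-length r)

-- Executes w backwards from the empty system; configurations in which a move
-- cannot be undone are left unchanged.
unrun : Word → List ℕ → List ℕ × List ℕ × List ℕ
unrun []      ys = [] , [] , []
unrun (ρ ∷ w) ys with unrun w ys
... | xs , x ∷ s , t = x ∷ xs , s , t
... | junk           = junk
unrun (ℓ ∷ w) ys with unrun w ys
... | xs , s , x ∷ t = xs , x ∷ s , t
... | junk           = junk
unrun (μ ∷ w) []       = unrun w []
unrun (μ ∷ w) (y ∷ ys) = let xs , s , t = unrun w ys in xs , s , y ∷ t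

unrun-run : ∀ {w xs s t ys} → Run w xs s t ys → unrun w ys ≡ (xs , s , t)
unrun-run []     = refl
unrun-run (ρ∷ r) rewrite unrun-run r = refl
unrun-run (ℓ∷ r) rewrite unrun-run r = refl
unrun-run (μ∷ r) rewrite unrun-run r = refl

preimage : Word → List ℕ → List ℕ
preimage w ys = proj₁ (unrun w ys)

-- Traces the chain back from its output. Entries may repeat, which is harmless for an upper bound.
preimages : ℕ → ℕ → List ℕ → List (List ℕ)
preimages n zero    ys = [ ys ]
preimages n (suc m) ys = cartesianProductWith preimage (normals n) (preimages n m ys)

length-cartesianProductWith : ∀ {A B C : Set} (f : A → B → C) xs ys →
  length (cartesianProductWith f xs ys) ≡ length xs * length ys
length-cartesianProductWith f []       ys = refl
length-cartesianProductWith f (x ∷ xs) ys =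
  trans (length-++ (map (f x) ys)) (cong₂ _+_ (length-map (f x) ys) (length-cartesianProductWith f xs ys))

length-preimages : ∀ n m ys → length (preimages n m ys) ≡ length (normals n) ^ m
length-preimages n zero    ys = refl
length-preimages n (suc m) ys =
  trans (length-cartesianProductWith preimage (normals n) (preimages n m ys))
        (cong (length (normals n) *_) (length-preimages n m ys))

-- Normalising a word keeps its input and output, so undoing the normal word still recovers `xs`.
∈-preimages : ∀ n m {xs ys} → length xs ≡ n → Chain m xs ys → xs ∈ preimages n m ys
∈-preimages n zero    len refl = here refl
∈-preimages n (suc m) len (ms , (w , r) , chain) =
  let v , nv , w⊑v = normalise w
      r′           = w⊑v r
      #μ≡n         = trans (run-#μ r′) len
      v∈           = normal∈extend v nv (trans (run-#ρ r′) len) (trans (run-#ℓ r′) len) #μ≡n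
      ms∈          = ∈-preimages n m (trans (run-length r′) #μ≡n) chain
  in subst (_∈ preimages n (suc m) _) (cong proj₁ (unrun-run r′)) (∈-cartesianProductWith⁺ preimage v∈ ms∈)

-- Decodes a Lehmer code: the leading digit is the image of `zero`, the rest codes the permutation
-- of the remaining points.
permutation : ∀ n → Fin (n !) → Permutation′ n
permutation zero    _ = idₚ
permutation (suc n) a = let i , b = remQuot {suc n} (n !) a in insert zero i (permutation n b)

permutation-injective : ∀ n a b → (∀ i → permutation n a ⟨$⟩ʳ i ≡ permutation n b ⟨$⟩ʳ i) → a ≡ b
permutation-injective zero    zero zero _ = refl
permutation-injective (suc n) a b eq = begin
  a                                            ≡⟨ combine-remQuot {suc n} (n !) a ⟨
  uncurry combine (remQuot {suc n} (n !) a)    ≡⟨ cong₂ combine i≡j c≡d ⟩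
  uncurry combine (remQuot {suc n} (n !) b)    ≡⟨ combine-remQuot {suc n} (n !) b ⟩
  b                                            ∎
  where
  open ≡-Reasoning
  i j : Fin (suc n)
  i = proj₁ (remQuot {suc n} (n !) a)
  j = proj₁ (remQuot {suc n} (n !) b)
  c d : Fin (n !)
  c = proj₂ (remQuot {suc n} (n !) a)
  d = proj₂ (remQuot {suc n} (n !) b)
  i≡j : i ≡ j
  i≡j = eq zero
  tails : ∀ k → punchIn i (permutation n c ⟨$⟩ʳ k) ≡ punchIn j (permutation n d ⟨$⟩ʳ k)
  tails k = trans (sym (insert-punchIn zero i (permutation n c) k))
                  (trans (eq (suc k)) (insert-punchIn zero j (permutation n d) k))
  c≡d : c ≡ d
  c≡d = permutation-injective n c d λ k →
    punchIn-injective i _ _ (trans (tails k) (cong (λ h → punchIn h (permutation n d ⟨$⟩ʳ k)) (sym i≡j)))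

map-≡⇒≗ : ∀ {A B : Set} {f g : A → B} {xs x} → map f xs ≡ map g xs → x ∈ xs → f x ≡ g x
map-≡⇒≗ {xs = _ ∷ _} eq (here refl) = ∷-injectiveˡ eq
map-≡⇒≗ {xs = _ ∷ _} eq (there x∈)  = map-≡⇒≗ (∷-injectiveʳ eq) x∈

permWord-injective : ∀ {n} (π σ : Permutation′ n) → permWord π ≡ permWord σ → ∀ i → π ⟨$⟩ʳ i ≡ σ ⟨$⟩ʳ i
permWord-injective π σ eq i = toℕ-injective (map-≡⇒≗ eq (∈-allFin i))

length-permWord : ∀ {n} (π : Permutation′ n) → length (permWord π) ≡ n
length-permWord {n} π = trans (length-map _ (allFin n)) (length-tabulate {n = n} (λ i → i))

-- Pigeonhole: the entry at a position determines the permutation, so distinct permutations occupy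
-- distinct positions of the list.
factorial-bound : ∀ n k → AllSortable n k → n ! ≤ length (normals n) ^ ⌈ k /2⌉
factorial-bound n k sortable = subst (n ! ≤_) (length-preimages n ⌈ k /2⌉ (upTo n)) (injective⇒≤ position-injective)
  where
  member : ∀ a → permWord (permutation n a) ∈ preimages n ⌈ k /2⌉ (upTo n)
  member a = let π = permutation n a in
    ∈-preimages n ⌈ k /2⌉ (length-permWord π) (sortable⇒chain k π (sortable π))
  position : Fin (n !) → Fin (length (preimages n ⌈ k /2⌉ (upTo n)))
  position a = index (member a)
  position-injective : ∀ {a b} → position a ≡ position b → a ≡ b
  position-injective {a} {b} eq = permutation-injective n a b (permWord-injective (permutation n a) (permutation n b)
    (trans (lookup-index (member a))
      (trans (cong (lookup (preimages n ⌈ k /2⌉ (upTo n))) eq) (sym (lookup-index (member b))))))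

-- Extracting the bound on n

^-cancelˡ-≤ : ∀ n .{{_ : NonZero n}} {a b} → a ^ n ≤ b ^ n → a ≤ b
^-cancelˡ-≤ n a^n≤b^n = ≮⇒≥ λ b<a → <⇒≱ (^-monoˡ-< n b<a) a^n≤b^n

-- Bernoulli's inequality (1 - 1/(n+1))ʰ ≥ 1 - h/(n+1), cleared of denominators and subtraction.
bernoulli : ∀ n h → suc n ^ h * suc n ≤ n ^ h * suc n + h * suc n ^ h
bernoulli n zero    = ≤-reflexive (sym (+-identityʳ (1 * suc n)))
bernoulli n (suc h) = begin
  suc n * suc n ^ h * suc n                                         ≡⟨ *-assoc (suc n) (suc n ^ h) (suc n) ⟩
  suc n * (suc n ^ h * suc n)                                       ≤⟨ *-monoʳ-≤ (suc n) (bernoulli n h) ⟩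
  suc n * (n ^ h * suc n + h * suc n ^ h)                           ≡⟨ expand n h (n ^ h) (suc n ^ h) ⟩
  n * n ^ h * suc n + (suc n * n ^ h + h * (suc n * suc n ^ h))     ≤⟨ +-monoʳ-≤ (n * n ^ h * suc n)
    (+-monoˡ-≤ (h * (suc n * suc n ^ h)) (*-monoʳ-≤ (suc n) (^-monoˡ-≤ h (n≤1+n n)))) ⟩
  n * n ^ h * suc n + (suc n * suc n ^ h + h * (suc n * suc n ^ h)) ∎
  where
  open ≤-Reasoning
  expand : ∀ n h a b → suc n * (a * suc n + h * b) ≡ n * a * suc n + (suc n * a + h * (suc n * b))
  expand = solve-∀

[1+n]^h≤2n^h : ∀ n h → h + h ≤ suc n → suc n ^ h ≤ 2 * n ^ h
[1+n]^h≤2n^h n h 2h≤1+n = *-cancelʳ-≤ (suc n ^ h) (2 * n ^ h) (suc n) (+-cancelʳ-≤ (suc n * b) _ _ (begin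
  b * suc n + suc n * b                 ≡⟨ double (suc n) b ⟩
  2 * (b * suc n)                       ≤⟨ *-monoʳ-≤ 2 (bernoulli n h) ⟩
  2 * (n ^ h * suc n + h * b)           ≡⟨ regroup (suc n) h (n ^ h) b ⟩
  2 * n ^ h * suc n + (h + h) * b       ≤⟨ +-monoʳ-≤ (2 * n ^ h * suc n) (*-monoˡ-≤ b 2h≤1+n) ⟩
  2 * n ^ h * suc n + suc n * b         ∎))
  where
  open ≤-Reasoning
  b : ℕ
  b = suc n ^ h
  double : ∀ m b → b * m + m * b ≡ 2 * (b * m)
  double = solve-∀
  regroup : ∀ m h a b → 2 * (a * m + h * b) ≡ 2 * a * m + (h + h) * b
  regroup = solve-∀

⌈n/2⌉+⌈n/2⌉≤1+n : ∀ n → ⌈ n /2⌉ + ⌈ n /2⌉ ≤ suc n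
⌈n/2⌉+⌈n/2⌉≤1+n n = ≤-trans (+-monoʳ-≤ ⌈ n /2⌉ (⌊n/2⌋-mono (n≤1+n (suc n))))
  (≤-reflexive (⌊n/2⌋+⌈n/2⌉≡n (suc n)))

-- An integer substitute for (1 + 1/n)ⁿ < e: each half of the exponent costs a factor 2 by
-- Bernoulli.
[1+n]^n≤4n^n : ∀ n → suc n ^ n ≤ 4 * n ^ n
[1+n]^n≤4n^n n = begin
  suc n ^ n                     ≡⟨ split (suc n) ⟩
  suc n ^ f * suc n ^ c         ≤⟨ *-mono-≤ ([1+n]^h≤2n^h n f 2f≤1+n) ([1+n]^h≤2n^h n c (⌈n/2⌉+⌈n/2⌉≤1+n n)) ⟩
  2 * n ^ f * (2 * n ^ c)       ≡⟨ regroup (n ^ f) (n ^ c) ⟩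
  4 * (n ^ f * n ^ c)           ≡⟨ cong (4 *_) (split n) ⟨
  4 * n ^ n                     ∎
  where
  open ≤-Reasoning
  f c : ℕ
  f = ⌊ n /2⌋
  c = ⌈ n /2⌉
  2f≤1+n : f + f ≤ suc n
  2f≤1+n = ≤-trans (+-mono-≤ (⌊n/2⌋≤⌈n/2⌉ n) (⌊n/2⌋≤⌈n/2⌉ n)) (⌈n/2⌉+⌈n/2⌉≤1+n n)
  split : ∀ a → a ^ n ≡ a ^ f * a ^ c
  split a = trans (cong (a ^_) (sym (⌊n/2⌋+⌈n/2⌉≡n n))) (^-distribˡ-+-* a f c)
  regroup : ∀ a b → 2 * a * (2 * b) ≡ 4 * (a * b)
  regroup = solve-∀

n^n≤4^n*n! : ∀ n → n ^ n ≤ 4 ^ n * n !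
n^n≤4^n*n! zero    = ≤-refl
n^n≤4^n*n! (suc n) = begin
  suc n * suc n ^ n             ≤⟨ *-monoʳ-≤ (suc n) ([1+n]^n≤4n^n n) ⟩
  suc n * (4 * n ^ n)           ≤⟨ *-monoʳ-≤ (suc n) (*-monoʳ-≤ 4 (n^n≤4^n*n! n)) ⟩
  suc n * (4 * (4 ^ n * n !))   ≡⟨ regroup (suc n) (4 ^ n) (n !) ⟩
  4 * 4 ^ n * (suc n * n !)     ∎
  where
  open ≤-Reasoning
  regroup : ∀ a b c → a * (4 * (b * c)) ≡ 4 * b * (a * c)
  regroup = solve-∀

^-^-comm : ∀ a m n → (a ^ m) ^ n ≡ (a ^ n) ^ m
^-^-comm a m n = trans (^-*-assoc a m n) (trans (cong (a ^_) (*-comm m n)) (sym (^-*-assoc a n m)))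

-- The inequality is proved for the `n`-th powers of both sides, where nⁿ ≤ 4ⁿ n! links it to the
-- count.
root-bound : ∀ A n .{{_ : NonZero n}} m p q → A * p ^ n ≤ q ^ n → n ! ≤ A ^ m → n * p ^ m ≤ 4 * q ^ m
root-bound A n m p q rate count = ^-cancelˡ-≤ n (begin
  (n * p ^ m) ^ n               ≡⟨ ^-distribʳ-* n (p ^ m) n ⟩
  n ^ n * (p ^ m) ^ n           ≡⟨ cong (n ^ n *_) (^-^-comm p m n) ⟩
  n ^ n * (p ^ n) ^ m           ≤⟨ *-monoˡ-≤ ((p ^ n) ^ m) (n^n≤4^n*n! n) ⟩
  4 ^ n * n ! * (p ^ n) ^ m     ≤⟨ *-monoˡ-≤ ((p ^ n) ^ m) (*-monoʳ-≤ (4 ^ n) count) ⟩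
  4 ^ n * A ^ m * (p ^ n) ^ m   ≡⟨ *-assoc (4 ^ n) (A ^ m) ((p ^ n) ^ m) ⟩
  4 ^ n * (A ^ m * (p ^ n) ^ m) ≡⟨ cong (4 ^ n *_) (^-distribʳ-* A (p ^ n) m) ⟨
  4 ^ n * (A * p ^ n) ^ m       ≤⟨ *-monoʳ-≤ (4 ^ n) (^-monoˡ-≤ m rate) ⟩
  4 ^ n * (q ^ n) ^ m           ≡⟨ cong (4 ^ n *_) (^-^-comm q n m) ⟩
  4 ^ n * (q ^ m) ^ n           ≡⟨ ^-distribʳ-* 4 (q ^ m) n ⟨
  (4 * q ^ m) ^ n               ∎)
  where open ≤-Reasoning

-- Here `d` is 1 for even and 0 for odd `k`; the summand 2 reserves two factors for `square-bound`.
k+3≡2⌈k/2⌉+2+d : ∀ k → ∃ λ d → k + 3 ≡ ⌈ k /2⌉ + ⌈ k /2⌉ + (2 + d)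
k+3≡2⌈k/2⌉+2+d zero          = 1 , refl
k+3≡2⌈k/2⌉+2+d (suc zero)    = 0 , refl
k+3≡2⌈k/2⌉+2+d (suc (suc k)) = let d , eq = k+3≡2⌈k/2⌉+2+d k in
  d , trans (cong (λ x → suc (suc x)) eq) (cong (λ x → suc (x + (2 + d))) (sym (+-suc ⌈ k /2⌉ ⌈ k /2⌉)))

-- Squaring removes the halving of `k` and turns 4 into 16, which two extra factors q/p absorb.
square-bound : ∀ n k p q → p ≤ q → 16 * (p * p) ≤ q * q → n * p ^ ⌈ k /2⌉ ≤ 4 * q ^ ⌈ k /2⌉ →
  n * n * p ^ (k + 3) ≤ q ^ (k + 3)
square-bound n k p q p≤q 16p²≤q² bound with k+3≡2⌈k/2⌉+2+d k
... | d , eq = begin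
  n * n * p ^ (k + 3)                                       ≡⟨ cong (n * n *_) (split p) ⟩
  n * n * (p ^ m * p ^ m * (p * (p * p ^ d)))               ≡⟨ regroup₁ n (p ^ m) p (p ^ d) ⟩
  n * p ^ m * (n * p ^ m) * (p * p * p ^ d)                 ≤⟨ *-monoˡ-≤ (p * p * p ^ d) (*-mono-≤ bound bound) ⟩
  4 * q ^ m * (4 * q ^ m) * (p * p * p ^ d)                 ≡⟨ regroup₂ (q ^ m) p (p ^ d) ⟩
  q ^ m * q ^ m * (16 * (p * p) * p ^ d)                    ≤⟨ *-monoʳ-≤ (q ^ m * q ^ m) (*-mono-≤ 16p²≤q² (^-monoˡ-≤ d p≤q)) ⟩
  q ^ m * q ^ m * (q * q * q ^ d)                           ≡⟨ cong (q ^ m * q ^ m *_) (*-assoc q q (q ^ d)) ⟩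
  q ^ m * q ^ m * (q * (q * q ^ d))                         ≡⟨ split q ⟨
  q ^ (k + 3)                                               ∎
  where
  open ≤-Reasoning
  m : ℕ
  m = ⌈ k /2⌉
  split : ∀ a → a ^ (k + 3) ≡ a ^ m * a ^ m * (a * (a * a ^ d))
  split a = trans (cong (a ^_) eq) (trans (^-distribˡ-+-* a (m + m) (2 + d)) (cong (_* a ^ (2 + d)) (^-distribˡ-+-* a m m)))
  regroup₁ : ∀ n x p y → n * n * (x * x * (p * (p * y))) ≡ n * x * (n * x) * (p * p * y)
  regroup₁ = solve-∀
  regroup₂ : ∀ x p y → 4 * x * (4 * x) * (p * p * y) ≡ x * x * (16 * (p * p) * y)
  regroup₂ = solve-∀

-- In logarithms this reads 2 log n ≤ (k + C) log 14.864, with `C` as the O(1); it applies to every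
-- sufficient `k`, in particular the least.
theorem2 : ∃ λ C → ∃ λ N → ∀ n → N ≤ n → ∀ k → AllSortable n k →
    n * n * 1000 ^ (k + C) ≤ 14864 ^ (k + C)
-- In 3, one unit pays for rounding k/2 up and two for the factor 16. The threshold 2000 is a round
-- number above about 1915, where (14864/14856)ⁿ passes 628/224.
theorem2 = 3 , 2000 , λ n 2000≤n k sortable →
  square-bound n k 1000 14864 (≤ᵇ⇒≤ 1000 14864 tt) (≤ᵇ⇒≤ (16 * (1000 * 1000)) (14864 * 14864) tt)
    (root-bound (length (normals n)) n {{>-nonZero (≤-trans (s≤s z≤n) 2000≤n)}} ⌈ k /2⌉ 1000 14864
      (normals-rate n 2000≤n) (factorial-bound n k sortable))
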